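{- Let $n\ge 2$. For any $0\le i\le n$ and any $b\in\{0,1\}$, put $i':=n+b+(-1)^{b+1}i$. Then, as maps $\mathcal{M}_n\to\mathcal{M}_{n+1}$, $$\mathcal{I}^{(n)}_{i'}=(F_{n+1})^{ -1}\circ I^{(n)}_{i,b}\circ F_n ,$$ where $F_m:\mathcal{M}_m\to\{0,1\}^m$ is the bijection $w_J\mapsto(x_1,\dots,x_m)$ with $x_i=1$ if $i\in J$ and $x_i=0$ otherwise.
   Context: For $m\ge2$ let $\epsilon_1,\dots,\epsilon_m$ be the standard basis of $\mathbb{R}^m$, $\alpha_1:=\epsilon_1$, $\alpha_i:=\epsilon_i-\epsilon_{i-1}$ for $2\le i\le m$, $s_i$ the orthogonal reflection associated with $\alpha_i$, and $W(B_m)$ the group generated by $s_1,\dots,s_m$. $W(B_n)$ is regarded as the subgroup of $W(B_{n+1})$ generated by $s_1,\dots,s_n$. For $J=\{j_1<\dots<j_t\}\subseteq\{1,\dots,m\}$ let $w_J:=w_{j_1}w_{j_2}\cdots w_{j_t}$ (composition of maps, rightmost applied first), where $w_j:=s_js_{j-1}\cdots s_1$ and $w_\emptyset=\mathrm{id}$; let $\mathcal{M}_m:=\{w_J\mid J\subseteq\{1,\dots,m\}\}$. Then $\mathcal{M}_n\subset\mathcal{M}_{n+1}$. Let $W(A_{m-1})$ be the subgroup of $W(B_m)$ generated by $s_2,\dots,s_m$, i.e. the stabilizer of $(1/2,\dots,1/2)$; write $[w]=wW(A_{m-1})$. $\mathcal{M}_m$ is the set of minimal-length representatives of the cosets in $W(B_m)/W(A_{m-1})$,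 and $W(B_m)$ acts on $\mathcal{M}_m$ by $v\cdot w:=$ the minimal-length representative of $[vw]$. Bit insertion: for $0\le i\le n$, $b\in\{0,1\}$, $I^{(n)}_{i,b}(x_1\cdots x_n):=x_1\cdots x_i\,b\,x_{i+1}\cdots x_n$. Elements $\mathcal{I}^{(n)}_j\in W(B_{n+1})$ for $0\le j\le 2n+1$: $\mathcal{I}^{(n)}_0:=\mathrm{id}$; $\mathcal{I}^{(n)}_j:=s_{n+2-j}\cdots s_ns_{n+1}$ for $1\le j\le n$; $\mathcal{I}^{(n)}_j:=s_{j-n}\cdots s_2s_1\,\mathcal{I}^{(n)}_n$ for $n+1\le j\le 2n+1$. As a map $\mathcal{M}_n\to\mathcal{M}_{n+1}$, $\mathcal{I}^{(n)}_j$ sends $w\in\mathcal{M}_n\subset\mathcal{M}_{n+1}$ to $\mathcal{I}^{(n)}_j\cdot w$, i.e. to the minimal-length representative of the coset $\mathcal{I}^{(n)}_j w\,W(A_n)$ in $W(B_{n+1})/W(A_n)$. -}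

module Defs where

open import Level using (_⊔_)
open import Algebra.Apartness.Bundles using (HeytingField; HeytingCommutativeRing)
import Algebra.Apartness.Properties.HeytingCommutativeRing as HeytingProperties
open import Algebra.Bundles using (CommutativeRing)
import Algebra.Properties.Ring as RingProperties
import Algebra.Properties.Semiring.Sum as SemiringSum
open import Data.Bool.Base using (Bool; true; false; not; if_then_else_)
open import Data.Digit using (Bit; 0b; 1b)
open import Data.Fin.Base as Fin using (Fin; zero; suc; toℕ; inject₁)
import Data.Fin.Properties as Fin
open import Data.Fin.Subset using (Subset; _∈_)
open import Data.Fin.Subset.Properties using (_∈?_)
open import Data.Integer.Base as ℤ using (ℤ; +_; -1ℤ)
open import Data.List.Base using (List; []; _∷_; _++_; foldr; length; map; concatMap; filter; reverse; take; drop; allFin)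
import Data.List.Properties as List
open import Data.List.Membership.Propositional using () renaming (_∈_ to _∈ˡ_)
open import Data.List.Membership.Propositional.Properties using (∈-filter⁺; ∈-filter⁻; ∈-allFin)
open import Data.List.Relation.Unary.All as All using (All)
open import Data.List.Relation.Unary.AllPairs as AllPairs using (AllPairs)
import Data.List.Relation.Unary.AllPairs.Properties as AllPairs
open import Data.List.Relation.Unary.Any using (here; there)
open import Data.Nat.Base as ℕ using (ℕ; zero; suc; _≤_; _<_; _∸_)
import Data.Nat.Properties as ℕ
open import Data.Product.Base using (∃; ∃-syntax; _×_; _,_; proj₁; proj₂)
open import Data.Vec.Base as Vec using (Vec; lookup; tabulate)
import Data.Vec.Properties as Vec
open import Data.Vec.Functional using (Vector)
import Data.Vec.Functional.Relation.Binary.Equality.Setoid as VectorEquality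
open import Function.Base using (_∘_; id)
open import Function.Bundles using (Inverse)
open import Relation.Binary.Bundles using (Setoid)
import Relation.Binary.Reasoning.Setoid as SetoidReasoning
open import Relation.Binary.PropositionalEquality as ≡ using (_≡_; _≢_)
open import Relation.Nullary using (¬_; Dec; does; yes; no; contradiction)
open import Relation.Nullary.Decidable using (dec-true; dec-false)

-- Letters are numbered from 0: the letter k : Fin m stands for the simple
-- reflection s_{k+1}.
Word : ℕ → Set
Word m = List (Fin m)

-- s_j ⋯ s_2 s_1
descending : ∀ {m} → ℕ → Word m
descending j = reverse (take j (allFin _))

-- w_j, where again the index k stands for j = k + 1.
wⱼ : ∀ {m} → Fin m → Word m
wⱼ k = descending (suc (toℕ k))

elements : ∀ {m} → Subset m → List (Fin m)
elements J = filter (_∈? J) (allFin _)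

wᴶ : ∀ {m} → Subset m → Word m
wᴶ J = concatMap wⱼ (elements J)

-- The last j letters s_{n+2-j} ⋯ s_n s_{n+1}; the empty word for j = 0.
ascending : ∀ n → ℕ → Word (suc n)
ascending n j = drop (suc n ∸ j) (allFin (suc n))

-- Meant for j ≤ 2n + 1.
𝓘 : ∀ n → ℕ → Word (suc n)
𝓘 n j with j ℕ.≤? n
... | yes _ = ascending n j
... | no  _ = descending (j ∸ n) ++ ascending n n

-- i′ = n + b + (-1)^{b+1} i, which is nonnegative because i ≤ n.
i′ : ∀ n → Fin (suc n) → Bit → ℕ
i′ n i b = ℤ.∣ + n ℤ.+ + toℕ b ℤ.+ (-1ℤ ℤ.^ suc (toℕ b)) ℤ.* + toℕ i ∣

-- The inclusion W(B_n) ⊂ W(B_{n+1}) that matches the generators s_1, …, s_n.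
ι : ∀ {n} → Word n → Word (suc n)
ι = map inject₁

-- Words in the generators s_2, …, s_m of W(A_{m-1}).
AWord : ∀ {m} → Word m → Set
AWord = All (λ k → 0 < toℕ k)

-- The standard library has no real numbers.  Everything below is over an
-- arbitrary field in which 2 is invertible; ℝ is such a field.
TwoInvertible : ∀ {c ℓ₁ ℓ₂} → HeytingField c ℓ₁ ℓ₂ → Set ℓ₂
TwoInvertible K = (1# + 1#) # 0#
  where open HeytingField K

module TypeB {c ℓ₁ ℓ₂} (K : HeytingField c ℓ₁ ℓ₂) (2#0 : TwoInvertible K) where

  open HeytingField K hiding (zero)
  open HeytingCommutativeRing heytingCommutativeRing using (commutativeRing)
  open CommutativeRing commutativeRing using (ring; semiring)
  open HeytingProperties heytingCommutativeRing using (1#0; #-congʳ; x-0≈x)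
  open RingProperties ring
  open SemiringSum semiring using (sum; sum-cong-≋; sum-replicate-zero; ∑-distrib-+)
  open VectorEquality setoid using (_≋_; ≋-refl; ≋-sym; ≋-trans)

  infix 4 _≈ʷ_
  infix 8 _·_

  V : ℕ → Set c
  V = Vector Carrier

  _·_ : ∀ {m} → V m → V m → Carrier
  u · v = sum (λ k → u k * v k)

  ε : ∀ {m} → Fin m → V m
  ε k l = if does (k Fin.≟ l) then 1# else 0#

  α : ∀ {m} → Fin m → V m
  α zero    = ε zero
  α (suc k) = λ l → ε (suc k) l - ε (inject₁ k) l

  -- #⇒invertible yields an inverse of a·a - 0.
  reflection : ∀ {m} (a : V m) → a · a # 0# → V m → V m
  reflection a a·a#0 v = λ l → v l - (1# + 1#) * (v · a) * norm⁻¹ * a l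
    where
    norm⁻¹ : Carrier
    norm⁻¹ = proj₁ (#⇒invertible a·a#0)

  module SimpleRoots where

    ·-ε : ∀ {m} (v : V m) k → v · ε k ≈ v k
    ·-ε {suc m} v zero = trans
      (+-cong (*-identityʳ _)
        (trans (sum-cong-≋ {m} (λ l → zeroʳ (v (suc l)))) (sum-replicate-zero m)))
      (+-identityʳ _)
    ·-ε v (suc k) = trans
      (+-cong (zeroʳ _) (·-ε (v ∘ suc) k))
      (+-identityˡ _)

    -‿sum : ∀ {m} (v : V m) → sum (λ l → - v l) ≈ - sum v
    -‿sum {zero}  v = sym -0#≈0#
    -‿sum {suc m} v = trans (+-congˡ (-‿sum (v ∘ suc))) (-‿+-comm _ _)

    ·-α-suc : ∀ {m} (v : V (suc m)) k → v · α (suc k) ≈ v (suc k) - v (inject₁ k)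
    ·-α-suc v k = begin
      sum (λ l → v l * (a l - b l))             ≈⟨ sum-cong-≋ (λ l → x[y-z]≈xy-xz (v l) (a l) (b l)) ⟩
      sum (λ l → v l * a l - v l * b l)         ≈⟨ ∑-distrib-+ (λ l → v l * a l) (λ l → - (v l * b l)) ⟩
      v · a + sum (λ l → - (v l * b l))         ≈⟨ +-congˡ (-‿sum (λ l → v l * b l)) ⟩
      v · a - v · b                             ≈⟨ +-cong (·-ε v (suc k)) (-‿cong (·-ε v (inject₁ k))) ⟩
      v (suc k) - v (inject₁ k)                 ∎
      where
      open SetoidReasoning setoid
      a = ε (suc k)
      b = ε (inject₁ k)

    ε-diag : ∀ {m} (k : Fin m) → ε k k ≡ 1#
    ε-diag k rewrite dec-true (k Fin.≟ k) ≡.refl = ≡.refl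

    ε-off : ∀ {m} {k l : Fin m} → k ≢ l → ε k l ≡ 0#
    ε-off {k = k} {l} k≢l rewrite dec-false (k Fin.≟ l) k≢l = ≡.refl

    suc≢inject₁ : ∀ {m} (k : Fin m) → suc k ≢ inject₁ k
    suc≢inject₁ k eq = ℕ.1+n≢n (≡.trans (≡.cong toℕ eq) (Fin.toℕ-inject₁ k))

    1-0 : ∀ {x y} → x ≡ 1# → y ≡ 0# → x - y ≈ 1#
    1-0 ≡.refl ≡.refl = x-0≈x 1#

    0-1 : ∀ {x y} → x ≡ 0# → y ≡ 1# → x - y ≈ - 1#
    0-1 ≡.refl ≡.refl = +-identityˡ (- 1#)

    α-head : ∀ {m} (k : Fin m) → α (suc k) (suc k) ≈ 1#
    α-head k = 1-0 (ε-diag (suc k)) (ε-off (suc≢inject₁ k ∘ ≡.sym))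

    α-tail : ∀ {m} (k : Fin m) → α (suc k) (inject₁ k) ≈ - 1#
    α-tail k = 0-1 (ε-off (suc≢inject₁ k)) (ε-diag (inject₁ k))

  open SimpleRoots

  α·α-zero : ∀ m → α {suc m} zero · α zero ≈ 1#
  α·α-zero m = ·-ε {suc m} (ε zero) zero

  α·α-suc : ∀ {m} (k : Fin m) → α (suc k) · α (suc k) ≈ 1# + 1#
  α·α-suc k = trans (·-α-suc (α (suc k)) k)
    (+-cong (α-head k) (trans (-‿cong (α-tail k)) (-‿involutive 1#)))

  α·α#0 : ∀ {m} (k : Fin m) → α k · α k # 0#
  α·α#0 {suc m} zero = #-congʳ (sym (α·α-zero m)) 1#0
  α·α#0 (suc k)      = #-congʳ (sym (α·α-suc k)) 2#0

  s : ∀ {m} → Fin m → V m → V m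
  s k = reflection (α k) (α·α#0 k)

  ⟦_⟧ : ∀ {m} → Word m → V m → V m
  ⟦ w ⟧ v = foldr s v w

  -- W(B_m) is represented by the words in its generators, two words being
  -- equal when they compose to the same map.  Inverse letters are not needed
  -- because the generators are involutions.  Multiplication is _++_.
  _≈ʷ_ : ∀ {m} → Word m → Word m → Set (c ⊔ ℓ₁)
  u ≈ʷ w = ∀ v → ⟦ u ⟧ v ≋ ⟦ w ⟧ v

  𝓜 : ℕ → Setoid (c ⊔ ℓ₁) (c ⊔ ℓ₁)
  𝓜 m = record
    { Carrier       = ∃[ w ] ∃[ J ] w ≈ʷ wᴶ {m} J
    ; _≈_           = λ x y → proj₁ x ≈ʷ proj₁ y
    ; isEquivalence = record
      { refl  = λ v → ≋-refl
      ; sym   = λ p v → ≋-sym (p v)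
      ; trans = λ p q v → ≋-trans (p v) (q v)
      }
    }

  -- k is the length of w with respect to s_1, …, s_m.
  IsLength : ∀ {m} → Word m → ℕ → Set (c ⊔ ℓ₁)
  IsLength w k = (∃[ u ] u ≈ʷ w × length u ≡ k) × (∀ u → u ≈ʷ w → k ≤ length u)

  -- u lies in the coset w W(A_{m-1}).
  _∈[_] : ∀ {m} → Word m → Word m → Set (c ⊔ ℓ₁)
  u ∈[ w ] = ∃[ p ] AWord p × u ≈ʷ w ++ p

  IsMinimalRepresentative : ∀ {m} → Word m → Word m → Set (c ⊔ ℓ₁)
  IsMinimalRepresentative w u =
    u ∈[ w ] ×
    ∃[ k ] IsLength u k × (∀ u′ k′ → u′ ∈[ w ] → IsLength u′ k′ → k ≤ k′)

  -- The graph of the action: v ∙ w ↦ u means that v · w is u.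
  _∙_↦_ : ∀ {m} → Word m → Word m → Word m → Set (c ⊔ ℓ₁)
  v ∙ w ↦ u = IsMinimalRepresentative (v ++ w) u

  -- What follows, up to F, shows that w_J determines J: the map w_J sends
  -- (1, …, 1) to the vector with entry -1 exactly at the positions in J.
  module Signs where

    Sign : ℕ → Set
    Sign m = Fin m → Bool

    ± : Bool → Carrier
    ± true  = - 1#
    ± false = 1#

    swap : ∀ {m} → Sign (suc m) → (k : Fin m) (l : Fin (suc m)) →
           Dec (l ≡ suc k) → Dec (l ≡ inject₁ k) → Bool
    swap A k l (yes _) _       = A (inject₁ k)
    swap A k l (no _)  (yes _) = A (suc k)
    swap A k l (no _)  (no _)  = A l

    act : ∀ {m} → Fin m → Sign m → Sign m
    act zero    A zero    = not (A zero)
    act zero    A (suc l) = A (suc l)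
    act (suc k) A l       = swap A k l (l Fin.≟ suc k) (l Fin.≟ inject₁ k)

    ⟪_⟫ : ∀ {m} → Word m → Sign m → Sign m
    ⟪ w ⟫ A = foldr act A w

    1≉-1 : ¬ (1# ≈ - 1#)
    1≉-1 p = #-irrefl (trans (+-congˡ p) (-‿inverseʳ 1#)) 2#0

    ±-injective : ∀ {a b} → ± a ≈ ± b → a ≡ b
    ±-injective {true}  {true}  _ = ≡.refl
    ±-injective {true}  {false} p = contradiction (sym p) 1≉-1
    ±-injective {false} {true}  p = contradiction p 1≉-1
    ±-injective {false} {false} _ = ≡.refl

    cancel : ∀ {n} (n#0 : n # 0#) → n * proj₁ (#⇒invertible n#0) ≈ 1#
    cancel n#0 = trans (*-congʳ (sym (x-0≈x _))) (proj₂ (proj₂ (#⇒invertible n#0)))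

    s-zero : ∀ {m} (v : V (suc m)) l → s zero v l ≈ v l - (1# + 1#) * v zero * ε zero l
    s-zero {m} v l = +-congˡ (-‿cong (*-congʳ (trans
      (*-cong (*-congˡ (·-ε v zero))
        (trans (sym (*-identityˡ _)) (trans (*-congʳ (sym (α·α-zero m))) (cancel (α·α#0 {suc m} zero)))))
      (*-identityʳ _))))

    s-suc : ∀ {m} (v : V (suc m)) k l →
            s (suc k) v l ≈ v l - (v (suc k) - v (inject₁ k)) * α (suc k) l
    s-suc v k l = +-congˡ (-‿cong (*-congʳ (begin
      (1# + 1#) * (v · α (suc k)) * n⁻¹            ≈⟨ *-congʳ (*-comm _ _) ⟩
      (v · α (suc k)) * (1# + 1#) * n⁻¹            ≈⟨ *-assoc _ _ _ ⟩
      (v · α (suc k)) * ((1# + 1#) * n⁻¹)          ≈⟨ *-congˡ (*-congʳ (sym (α·α-suc k))) ⟩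
      (v · α (suc k)) * ((α (suc k) · α (suc k)) * n⁻¹) ≈⟨ *-cong (·-α-suc v k) (cancel (α·α#0 (suc k))) ⟩
      (v (suc k) - v (inject₁ k)) * 1#             ≈⟨ *-identityʳ _ ⟩
      v (suc k) - v (inject₁ k)                    ∎)))
      where
      open SetoidReasoning setoid
      n⁻¹ = proj₁ (#⇒invertible (α·α#0 (suc k)))

    x-[x-y]≈y : ∀ x y → x - (x - y) ≈ y
    x-[x-y]≈y x y = begin
      x - (x - y)     ≈⟨ +-congˡ (-‿+-comm x (- y)) ⟨
      x + (- x - - y) ≈⟨ +-assoc _ _ _ ⟨
      (x - x) - - y   ≈⟨ +-cong (-‿inverseʳ x) (-‿involutive y) ⟩
      0# + y          ≈⟨ +-identityˡ y ⟩
      y               ∎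
      where open SetoidReasoning setoid

    s-negates : ∀ {m} (v : V (suc m)) → s zero v zero ≈ - v zero
    s-negates {m} v = begin
      s zero v zero                  ≈⟨ s-zero {m} v zero ⟩
      x - (1# + 1#) * x * 1#         ≈⟨ +-congˡ (-‿cong (*-identityʳ _)) ⟩
      x - (1# + 1#) * x              ≈⟨ +-congˡ (-‿cong (trans (distribʳ x 1# 1#) (+-cong (*-identityˡ x) (*-identityˡ x)))) ⟩
      x - (x + x)                    ≈⟨ +-congˡ (-‿cong (+-congˡ (-‿involutive x))) ⟨
      x - (x - - x)                  ≈⟨ x-[x-y]≈y x (- x) ⟩
      - x                            ∎
      where
      open SetoidReasoning setoid
      x = v zero

    s-fixes : ∀ x y {z} → z ≈ 0# → x - y * z ≈ x
    s-fixes x y z≈0 = trans (+-congˡ (-‿cong (trans (*-congˡ z≈0) (zeroʳ _)))) (x-0≈x _)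

    s-swaps₁ : ∀ {m} (v : V (suc m)) k → s (suc k) v (suc k) ≈ v (inject₁ k)
    s-swaps₁ v k = begin
      s (suc k) v (suc k)              ≈⟨ s-suc v k (suc k) ⟩
      x - (x - y) * α (suc k) (suc k)  ≈⟨ +-congˡ (-‿cong (trans (*-congˡ (α-head k)) (*-identityʳ _))) ⟩
      x - (x - y)                      ≈⟨ x-[x-y]≈y x y ⟩
      y                                ∎
      where
      open SetoidReasoning setoid
      x = v (suc k)
      y = v (inject₁ k)

    s-swaps₂ : ∀ {m} (v : V (suc m)) k → s (suc k) v (inject₁ k) ≈ v (suc k)
    s-swaps₂ v k = begin
      s (suc k) v (inject₁ k)              ≈⟨ s-suc v k (inject₁ k) ⟩
      y - (x - y) * α (suc k) (inject₁ k)  ≈⟨ +-congˡ (-‿cong (*-congˡ (α-tail k))) ⟩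
      y - (x - y) * - 1#                   ≈⟨ +-congˡ (-‿cong (-‿distribʳ-* (x - y) 1#)) ⟨
      y - - ((x - y) * 1#)                 ≈⟨ +-congˡ (trans (-‿involutive _) (*-identityʳ (x - y))) ⟩
      y + (x - y)                          ≈⟨ +-comm y (x - y) ⟩
      (x - y) + y                          ≈⟨ +-assoc x (- y) y ⟩
      x + (- y + y)                        ≈⟨ +-congˡ (-‿inverseˡ y) ⟩
      x + 0#                               ≈⟨ +-identityʳ x ⟩
      x                                    ∎
      where
      open SetoidReasoning setoid
      x = v (suc k)
      y = v (inject₁ k)

    s-other : ∀ {m} (v : V (suc m)) k l → l ≢ suc k → l ≢ inject₁ k → s (suc k) v l ≈ v l
    s-other v k l l≢ l≢′ = trans (s-suc v k l)
      (s-fixes (v l) (v (suc k) - v (inject₁ k))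
        (trans (+-cong (reflexive (ε-off (l≢ ∘ ≡.sym))) (-‿cong (reflexive (ε-off (l≢′ ∘ ≡.sym)))))
               (-‿inverseʳ 0#)))

    s-keeps : ∀ {m} (v : V (suc m)) l → s zero v (suc l) ≈ v (suc l)
    s-keeps {m} v l = trans (s-zero {m} v (suc l)) (s-fixes (v (suc l)) ((1# + 1#) * v zero) refl)

    -± : ∀ b → - ± b ≈ ± (not b)
    -± true  = -‿involutive 1#
    -± false = refl

    s-± : ∀ {m} k (A : Sign m) v → v ≋ ± ∘ A → s k v ≋ ± ∘ act k A
    s-± zero A v p zero    = trans (s-negates v) (trans (-‿cong (p zero)) (-± (A zero)))
    s-± zero A v p (suc l) = trans (s-keeps v l) (p (suc l))
    s-± (suc k) A v p l = go (l Fin.≟ suc k) (l Fin.≟ inject₁ k)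
      where
      go : ∀ d e → s (suc k) v l ≈ ± (swap A k l d e)
      go (yes ≡.refl) _            = trans (s-swaps₁ v k) (p (inject₁ k))
      go (no _)       (yes ≡.refl) = trans (s-swaps₂ v k) (p (suc k))
      go (no l≢)      (no l≢′)     = trans (s-other v k l l≢ l≢′) (p l)

    ⟦⟧-± : ∀ {m} w (A : Sign m) → ⟦ w ⟧ (± ∘ A) ≋ ± ∘ ⟪ w ⟫ A
    ⟦⟧-± []      A = ≋-refl
    ⟦⟧-± (k ∷ w) A = s-± k (⟪ w ⟫ A) _ (⟦⟧-± w A)

    ⟪⟫-++ : ∀ {m} u w (A : Sign m) → ⟪ u ++ w ⟫ A ≡ ⟪ u ⟫ (⟪ w ⟫ A)
    ⟪⟫-++ u w A = List.foldr-++ act A u w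

    wⱼ-step : ∀ {m} (k : Fin m) → wⱼ k ≡ k ∷ descending (toℕ k)
    wⱼ-step k = ≡.trans (≡.cong reverse (List.take-suc-tabulate id k))
      (List.reverse-++ (take (toℕ k) (allFin _)) (k ∷ []))

    -- w_j turns on position j when positions 1, …, j are off.
    record TurnsOn {m} (k : Fin m) (A B : Sign m) : Set where
      field
        on     : B k ≡ true
        others : ∀ l → l ≢ k → B l ≡ A l

    wⱼ-turnsOn : ∀ {m} (A : Sign m) t (k : Fin m) → toℕ k ≡ t →
                 (∀ l → toℕ l ≤ t → A l ≡ false) → TurnsOn k A (⟪ wⱼ k ⟫ A)
    wⱼ-turnsOn {suc m} A zero zero _ off rewrite wⱼ-step (zero {n = m}) = record
      { on     = ≡.cong not (off zero ℕ.z≤n)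
      ; others = λ { zero l≢ → contradiction ≡.refl l≢ ; (suc l) _ → ≡.refl }
      }
    wⱼ-turnsOn A (suc t) (suc k) eq off = ≡.subst (λ w → TurnsOn (suc k) A (⟪ w ⟫ A))
      (≡.sym (≡.trans (wⱼ-step (suc k)) (≡.cong (λ i → suc k ∷ descending (suc i)) (≡.sym (Fin.toℕ-inject₁ k)))))
      result
      where
      k≡t : toℕ k ≡ t
      k≡t = ℕ.suc-injective eq

      B : Sign _
      B = ⟪ wⱼ (inject₁ k) ⟫ A

      rec : TurnsOn (inject₁ k) A B
      rec = wⱼ-turnsOn A t (inject₁ k) (≡.trans (Fin.toℕ-inject₁ k) k≡t)
              (λ l l≤t → off l (ℕ.m≤n⇒m≤1+n l≤t))
      open TurnsOn rec

      on′ : act (suc k) B (suc k) ≡ true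
      on′ with suc k Fin.≟ suc k | suc k Fin.≟ inject₁ k
      ... | yes _ | _ = on
      ... | no ≢  | _ = contradiction ≡.refl ≢

      others′ : ∀ l → l ≢ suc k → act (suc k) B l ≡ A l
      others′ l l≢ with l Fin.≟ suc k | l Fin.≟ inject₁ k
      ... | yes l≡ | _ = contradiction l≡ l≢
      ... | no _ | yes ≡.refl = ≡.trans (others (suc k) (suc≢inject₁ k))
              (≡.trans (off (suc k) (ℕ.≤-reflexive eq))
                (≡.sym (off (inject₁ k) (ℕ.m≤n⇒m≤1+n (ℕ.≤-reflexive (≡.trans (Fin.toℕ-inject₁ k) k≡t))))))
      ... | no _ | no l≢′ = others l l≢′

      result : TurnsOn (suc k) A (act (suc k) B)
      result = record { on = on′ ; others = others′ }

    allOff : ∀ {m} → Sign m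
    allOff _ = false

    Marks : ∀ {m} → List (Fin m) → Sign m → Set
    Marks L A = ∀ l → (l ∈ˡ L → A l ≡ true) × (¬ l ∈ˡ L → A l ≡ false)

    marks : ∀ {m} (L : List (Fin m)) → AllPairs Fin._<_ L → Marks L (⟪ concatMap wⱼ L ⟫ allOff)
    marks []      _ l = (λ ()) , λ _ → ≡.refl
    marks (k ∷ L) (k< AllPairs.∷ L<) rewrite ⟪⟫-++ (wⱼ k) (concatMap wⱼ L) allOff = λ l →
      (λ { (here ≡.refl) → on
         ; (there l∈) → ≡.trans (others l (λ { ≡.refl → ℕ.<-irrefl ≡.refl (All.lookup k< l∈) })) (proj₁ (ih l) l∈) }) ,
      (λ l∉ → ≡.trans (others l (l∉ ∘ here)) (proj₂ (ih l) (l∉ ∘ there)))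
      where
      ih = marks L L<
      open TurnsOn (wⱼ-turnsOn (⟪ concatMap wⱼ L ⟫ allOff) (toℕ k) k ≡.refl
             (λ l l≤k → proj₂ (ih l) (λ l∈ → ℕ.<-irrefl ≡.refl (ℕ.<-≤-trans (All.lookup k< l∈) l≤k))))

    wᴶ-sign : ∀ {m} (J : Subset m) l → ⟪ wᴶ J ⟫ allOff l ≡ does (l ∈? J)
    wᴶ-sign J l with l ∈? J | marks (elements J) (AllPairs.filter⁺ (_∈? J) (AllPairs.tabulate⁺-< id)) l
    ... | yes l∈ | on , _  = on (∈-filter⁺ (_∈? J) (∈-allFin l) l∈)
    ... | no  l∉ | _ , off = off (l∉ ∘ proj₂ ∘ ∈-filter⁻ (_∈? J) {xs = allFin _})

  open Signs

  wᴶ-injective : ∀ {m} (J J′ : Subset m) → wᴶ J ≈ʷ wᴶ J′ →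
                 ∀ k → does (k ∈? J) ≡ does (k ∈? J′)
  wᴶ-injective J J′ p k = ≡.trans (≡.sym (wᴶ-sign J k)) (≡.trans
    (±-injective (trans (sym (⟦⟧-± (wᴶ J) allOff k))
      (trans (p (± ∘ allOff) k) (⟦⟧-± (wᴶ J′) allOff k))))
    (wᴶ-sign J′ k))

  characteristic : ∀ {m} → Subset m → Vec Bit m
  characteristic J = tabulate (λ k → if does (k ∈? J) then 1b else 0b)

  support : ∀ {m} → Vec Bit m → Subset m
  support x = tabulate (λ k → does (lookup x k Fin.≟ 1b))

  module Bits where

    does-∈? : ∀ {m} (J : Subset m) k → does (k ∈? J) ≡ lookup J k
    does-∈? (true  Vec.∷ J) zero    = ≡.refl
    does-∈? (false Vec.∷ J) zero    = ≡.refl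
    does-∈? (_     Vec.∷ J) (suc k) = does-∈? J k

    characteristic-support : ∀ {m} (x : Vec Bit m) → characteristic (support x) ≡ x
    characteristic-support x = ≡.trans (Vec.tabulate-cong bit) (Vec.tabulate∘lookup x)
      where
      back : ∀ b → (if does (b Fin.≟ 1b) then 1b else 0b) ≡ b
      back zero       = ≡.refl
      back (suc zero) = ≡.refl

      bit : ∀ k → (if does (k ∈? support x) then 1b else 0b) ≡ lookup x k
      bit k rewrite does-∈? (support x) k
                  | Vec.lookup∘tabulate (λ k → does (lookup x k Fin.≟ 1b)) k = back (lookup x k)

    characteristic-cong : ∀ {m} (J J′ : Subset m) → wᴶ J ≈ʷ wᴶ J′ → characteristic J ≡ characteristic J′
    characteristic-cong J J′ p =
      Vec.tabulate-cong (λ k → ≡.cong (if_then 1b else 0b) (wᴶ-injective J J′ p k))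

    support-characteristic : ∀ {m} (J : Subset m) → support (characteristic J) ≡ J
    support-characteristic J = ≡.trans (Vec.tabulate-cong bit) (Vec.tabulate∘lookup J)
      where
      back : ∀ b → does ((if b then 1b else 0b) Fin.≟ 1b) ≡ b
      back true  = ≡.refl
      back false = ≡.refl

      bit : ∀ k → does (lookup (characteristic J) k Fin.≟ 1b) ≡ lookup J k
      bit k rewrite Vec.lookup∘tabulate (λ k → if does (k ∈? J) then 1b else 0b) k
                  | does-∈? J k = back (lookup J k)

  open Bits

  F : ∀ m → Inverse (𝓜 m) (≡.setoid (Vec Bit m))
  F m = record
    { to        = λ (_ , J , _) → characteristic J
    ; from      = λ x → wᴶ (support x) , support x , λ _ → ≋-refl
    ; to-cong   = λ { {_ , J , p} {_ , J′ , p′} q →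
        characteristic-cong J J′ (λ v → ≋-trans (≋-sym (p v)) (≋-trans (q v) (p′ v))) }
    ; from-cong = λ { ≡.refl → λ _ → ≋-refl }
    ; inverse   =
        (λ { {x} {_ , J , p} q → ≡.trans
          (characteristic-cong J (support x) (λ v → ≋-trans (≋-sym (p v)) (q v)))
          (characteristic-support x) }) ,
        (λ { {_ , J , p} ≡.refl v → ≡.subst (λ J′ → ⟦ wᴶ J′ ⟧ v ≋ _)
          (≡.sym (support-characteristic J)) (≋-sym (p v)) })
    }

{-# OPTIONS --safe #-}
module Submission where

open import Defs
open import Level using (Level; _⊔_)
open import Algebra.Apartness.Bundles using (HeytingField; HeytingCommutativeRing)
open import Algebra.Bundles using (CommutativeRing)
import Algebra.Properties.Ring as RingProperties
open import Data.Bool.Base using (Bool; true; false; not)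
open import Data.Digit using (Bit; 0b; 1b)
open import Data.Fin.Base as Fin using (Fin; zero; suc; toℕ; fromℕ; fromℕ<; inject₁)
open import Data.Fin.Induction using (<-weakInduction; >-weakInduction)
import Data.Fin.Properties as Fin
open import Data.Fin.Subset using (Subset)
open import Data.Fin.Subset.Properties using (_∈?_)
import Data.Integer.Base as ℤ
open ℤ using (+_; -1ℤ)
import Data.Integer.Properties as ℤ
open import Data.List.Base using (List; []; _∷_; _++_; [_];
  concatMap; drop; foldr; length; reverse; tabulate; allFin)
open import Data.List.Membership.Propositional using (_∈_)
import Data.List.Membership.DecPropositional as DecMembership
import Data.List.Properties as List
open import Data.List.Relation.Unary.All as All using (All; []; _∷_)
import Data.List.Relation.Unary.All.Properties as All
open import Data.List.Relation.Unary.AllPairs as AllPairs using (AllPairs; []; _∷_)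
import Data.List.Relation.Unary.AllPairs.Properties as AllPairs
open import Data.List.Relation.Binary.Permutation.Propositional using (↭-sym)
open import Data.List.Relation.Binary.Permutation.Propositional.Properties
  using (All-resp-↭; ↭-reverse)
open import Data.List.Relation.Unary.Any using (here; there)
open import Data.Nat.Base using (ℕ; zero; suc; _+_; _∸_; _≤_; _<_; z≤n; s≤s; z<s)
import Data.Nat.Properties as ℕ
open import Data.Product.Base using (∃-syntax; _×_; _,_; proj₁; proj₂)
open import Data.Sum.Base using (_⊎_; inj₁; inj₂)
open import Data.Vec.Base using (Vec; _∷_; lookup; insertAt)
import Data.Vec.Properties as Vec
import Data.Vec.Functional as Vector
open Vector using (Vector) renaming (insertAt to insertᶠ)
open import Function.Base using (_∘_; id)
open import Function.Bundles using (Inverse; _⇔_; mk⇔)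
open import Relation.Binary.Bundles using (Setoid)
open import Relation.Binary.Definitions using (tri<; tri≈; tri>)
import Relation.Binary.Reasoning.Setoid as SetoidReasoning
open import Relation.Binary.PropositionalEquality as ≡ using (_≡_; _≢_; _≗_)
open import Relation.Nullary using (does; yes; no; contradiction)

-- The sign vector of a word is the image of (1, …, 1), which is fixed by
-- W(A_{m-1}); w_J has sign vector -1 exactly on J, so J is determined by the
-- coset of w_J.  Conversely, the Coxeter relations show that multiplying w_J on
-- the left by a generator s gives some w_{J'} with ℓ(w_{J'}) ≤ 1 + ℓ(w_J), or
-- w_J s' with s' ∈ W(A_{m-1}).  So every word u equals some w_J p with p a word
-- of W(A_{m-1}) and ℓ(w_J) + ℓ(p) at most the length of u, and hence w_J is the
-- unique minimal representative of its coset.  It remains to follow signs: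
-- adding the coordinate n + 1 puts a + at the end of the sign vector,
-- s_{i+2} ⋯ s_{n+1} moves this + to position i + 1, and for b = 1 the element
-- moves it to the front, s_1 negates it, and s_{i+1} ⋯ s_2 moves it to
-- position i + 1.

-- Adjacent transpositions of positions

-- The permutation of positions effected by the letter suc k.
τ : ∀ {m} → Fin m → Fin (suc m) → Fin (suc m)
τ zero    zero          = suc zero
τ zero    (suc zero)    = zero
τ zero    (suc (suc l)) = suc (suc l)
τ (suc k) zero          = zero
τ (suc k) (suc l)       = suc (τ k l)

τ-suc : ∀ {m} (k : Fin m) → τ k (suc k) ≡ inject₁ k
τ-suc zero    = ≡.refl
τ-suc (suc k) = ≡.cong suc (τ-suc k)

τ-inject₁ : ∀ {m} (k : Fin m) → τ k (inject₁ k) ≡ suc k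
τ-inject₁ zero    = ≡.refl
τ-inject₁ (suc k) = ≡.cong suc (τ-inject₁ k)

τ-other : ∀ {m} (k : Fin m) l → l ≢ suc k → l ≢ inject₁ k → τ k l ≡ l
τ-other zero    zero          _  l≢ = contradiction ≡.refl l≢
τ-other zero    (suc zero)    l≢ _  = contradiction ≡.refl l≢
τ-other zero    (suc (suc l)) _  _  = ≡.refl
τ-other (suc k) zero          _  _  = ≡.refl
τ-other (suc k) (suc l)       l≢ l≢′ =
  ≡.cong suc (τ-other k l (l≢ ∘ ≡.cong suc) (l≢′ ∘ ≡.cong suc))

τ-involutive : ∀ {m} (k : Fin m) l → τ k (τ k l) ≡ l
τ-involutive zero    zero          = ≡.refl
τ-involutive zero    (suc zero)    = ≡.refl
τ-involutive zero    (suc (suc l)) = ≡.refl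
τ-involutive (suc k) zero          = ≡.refl
τ-involutive (suc k) (suc l)       = ≡.cong suc (τ-involutive k l)

τ-comm : ∀ {m} (j k : Fin m) → suc (toℕ j) < toℕ k → ∀ l → τ j (τ k l) ≡ τ k (τ j l)
τ-comm zero    (suc (suc k)) _         zero          = ≡.refl
τ-comm zero    (suc (suc k)) _         (suc zero)    = ≡.refl
τ-comm zero    (suc (suc k)) _         (suc (suc l)) = ≡.refl
τ-comm zero    (suc zero)    (s≤s ())
τ-comm (suc j) (suc k)       _         zero          = ≡.refl
τ-comm (suc j) (suc k)       (s≤s j<k) (suc l)       = ≡.cong suc (τ-comm j k j<k l)

τ-braid : ∀ {m} (k k′ : Fin m) → toℕ k′ ≡ suc (toℕ k) →
          ∀ l → τ k (τ k′ (τ k l)) ≡ τ k′ (τ k (τ k′ l))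
τ-braid zero    (suc zero) _  zero                = ≡.refl
τ-braid zero    (suc zero) _  (suc zero)          = ≡.refl
τ-braid zero    (suc zero) _  (suc (suc zero))    = ≡.refl
τ-braid zero    (suc zero) _  (suc (suc (suc l))) = ≡.refl
τ-braid (suc k) (suc k′)   _  zero                = ≡.refl
τ-braid (suc k) (suc k′)   eq (suc l)             = ≡.cong suc (τ-braid k k′ (ℕ.suc-injective eq) l)

-- Inserting an entry into a vector

module _ {a} {A : Set a} where

  -- The transposition exchanges the inserted entry with its right neighbour, which amounts to
  -- inserting it one place later.
  τ-insertAt-up : ∀ {m} (xs : Vector A m) i b →
                  insertᶠ xs (inject₁ i) b ∘ τ i ≗ insertᶠ xs (suc i) b
  τ-insertAt-up {suc m} xs zero    b zero          = ≡.refl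
  τ-insertAt-up {suc m} xs zero    b (suc zero)    = ≡.refl
  τ-insertAt-up {suc m} xs zero    b (suc (suc l)) = ≡.refl
  τ-insertAt-up {suc m} xs (suc i) b zero          = ≡.refl
  τ-insertAt-up {suc m} xs (suc i) b (suc l)       = τ-insertAt-up (Vector.tail xs) i b l

  τ-insertAt-down : ∀ {m} (xs : Vector A m) i b →
                    insertᶠ xs (suc i) b ∘ τ i ≗ insertᶠ xs (inject₁ i) b
  τ-insertAt-down xs i b l =
    ≡.trans (≡.sym (τ-insertAt-up xs i b (τ i l))) (≡.cong (insertᶠ xs (inject₁ i) b) (τ-involutive i l))

  insertAt-cong : ∀ {m} {xs ys : Vector A m} → xs ≗ ys →
                  ∀ i b → insertᶠ xs i b ≗ insertᶠ ys i b
  insertAt-cong         eq zero    b zero    = ≡.refl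
  insertAt-cong         eq zero    b (suc l) = eq l
  insertAt-cong {suc m} eq (suc i) b zero    = eq zero
  insertAt-cong {suc m} eq (suc i) b (suc l) = insertAt-cong (eq ∘ suc) i b l

  insertAt-replicate : ∀ {m} (b : A) (i : Fin (suc m)) →
                       insertᶠ (Vector.replicate m b) i b ≗ Vector.replicate (suc m) b
  insertAt-replicate         b zero    zero    = ≡.refl
  insertAt-replicate         b zero    (suc l) = ≡.refl
  insertAt-replicate {suc m} b (suc i) zero    = ≡.refl
  insertAt-replicate {suc m} b (suc i) (suc l) = insertAt-replicate b i l

  lookup-insertAt : ∀ {b} {B : Set b} (f : A → B) {m} (xs : Vec A m) i x →
                    f ∘ lookup (insertAt xs i x) ≗ insertᶠ (f ∘ lookup xs) i (f x)
  lookup-insertAt f xs       zero    x zero    = ≡.refl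
  lookup-insertAt f xs       zero    x (suc l) = ≡.refl
  lookup-insertAt f (_ ∷ xs) (suc i) x zero    = ≡.refl
  lookup-insertAt f (_ ∷ xs) (suc i) x (suc l) = lookup-insertAt f xs i x l

  -- The new last position lies beyond both positions that `τ (inject₁ k)` exchanges.
  τ-insertAt-last : ∀ {m} (xs : Vector A (suc m)) k b →
                    insertᶠ xs (fromℕ (suc m)) b ∘ τ (inject₁ k) ≗
                    insertᶠ (xs ∘ τ k) (fromℕ (suc m)) b
  τ-insertAt-last {suc m} xs zero    b zero          = ≡.refl
  τ-insertAt-last {suc m} xs zero    b (suc zero)    = ≡.refl
  τ-insertAt-last {suc m} xs zero    b (suc (suc l)) = ≡.refl
  τ-insertAt-last {suc m} xs (suc k) b zero          = ≡.refl
  τ-insertAt-last {suc m} xs (suc k) b (suc l)       = τ-insertAt-last (Vector.tail xs) k b l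

drop-tabulate : ∀ {a} {A : Set a} {m} (f : Fin m → A) k →
                drop (toℕ k) (tabulate f) ≡ f k ∷ drop (suc (toℕ k)) (tabulate f)
drop-tabulate f zero    = ≡.refl
drop-tabulate f (suc k) = drop-tabulate (f ∘ suc) k

-- Explicit words for the insertion elements

i′-0b : ∀ n i → i′ n i 0b ≡ n ∸ toℕ i
i′-0b n i = begin
  ℤ.∣ + n ℤ.+ + 0 ℤ.+ -1ℤ ℤ.* + toℕ i ∣
    ≡⟨ ≡.cong₂ (λ x y → ℤ.∣ x ℤ.+ y ∣) (ℤ.+-identityʳ (+ n)) (ℤ.-1*i≡-i (+ toℕ i)) ⟩
  ℤ.∣ + n ℤ.- + toℕ i ∣
    ≡⟨ ≡.cong ℤ.∣_∣ (ℤ.m-n≡m⊖n n (toℕ i)) ⟩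
  ℤ.∣ n ℤ.⊖ toℕ i ∣
    ≡⟨ ≡.cong ℤ.∣_∣ (ℤ.⊖-≥ (Fin.toℕ≤pred[n] i)) ⟩
  n ∸ toℕ i ∎
  where open ≡.≡-Reasoning

i′-1b : ∀ n i → i′ n i 1b ≡ suc (n + toℕ i)
i′-1b n i = begin
  ℤ.∣ + (n + 1) ℤ.+ ℤ.1ℤ ℤ.* + toℕ i ∣
    ≡⟨ ≡.cong (λ x → ℤ.∣ + (n + 1) ℤ.+ x ∣) (ℤ.*-identityˡ (+ toℕ i)) ⟩
  n + 1 + toℕ i
    ≡⟨ ≡.cong (_+ toℕ i) (ℕ.+-comm n 1) ⟩
  suc (n + toℕ i) ∎
  where open ≡.≡-Reasoning

-- The word consists of the last `n - i` of `n + 1` letters, so `i + 1` letters are dropped and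
-- s_{i+2} ⋯ s_{n+1} remains; the subtractions are exact because `i ≤ n`.
𝓘-0b : ∀ n i → 𝓘 n (i′ n i 0b) ≡ drop (suc (toℕ i)) (allFin (suc n))
𝓘-0b n i rewrite i′-0b n i with n ∸ toℕ i ℕ.≤? n
... | yes _ = ≡.cong (λ t → drop t (allFin (suc n)))
                (≡.trans (ℕ.+-∸-assoc 1 (ℕ.m∸n≤m n (toℕ i)))
                  (≡.cong suc (ℕ.m∸[m∸n]≡n (Fin.toℕ≤pred[n] i))))
... | no ≰  = contradiction (ℕ.m∸n≤m n (toℕ i)) ≰

-- The index `n + 1 + i` always exceeds `n`, which selects the second branch of `𝓘`: its descending
-- part has `i + 1` letters and its ascending part is s_2 ⋯ s_{n+1}.
𝓘-1b : ∀ n i → 𝓘 n (i′ n i 1b) ≡ wⱼ i ++ drop 1 (allFin (suc n))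
𝓘-1b n i rewrite i′-1b n i with suc (n + toℕ i) ℕ.≤? n
... | yes n< = contradiction (ℕ.≤-<-trans (ℕ.m≤m+n n (toℕ i)) n<) (ℕ.<-irrefl ≡.refl)
... | no _   = ≡.cong₂ (λ s t → descending s ++ drop t (allFin (suc n)))
                 (≡.trans (≡.cong (_∸ n) (≡.sym (ℕ.+-suc n (toℕ i)))) (ℕ.m+n∸m≡n n (suc (toℕ i))))
                 (ℕ.m+n∸n≡m 1 n)

AWord-reverse : ∀ {m} {p : Word m} → AWord p → AWord (reverse p)
AWord-reverse {p = p} = All-resp-↭ (↭-sym (↭-reverse p))

-- Strictly increasing lists of indices

Sorted : ∀ {m} → List (Fin m) → Set
Sorted = AllPairs Fin._<_

-- Becomes `wᴶ J` at `elements J`; working with lists instead of subsets allows recursion on the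
-- leading factor.
⌊_⌋ : ∀ {m} → List (Fin m) → Word m
⌊ L ⌋ = concatMap wⱼ L

-- If the heads differed, each would occur in the tail of the other list and so be strictly larger
-- than the other.
head∈ : ∀ {m} {x y : Fin m} {L L′} → All (y Fin.<_) L′ → x ∈ y ∷ L′ → y ∈ x ∷ L →
        All (x Fin.<_) L → x ≡ y
head∈ y< (here eq)   _           _  = eq
head∈ y< (there x∈) (here eq)    _  = ≡.sym eq
head∈ y< (there x∈) (there y∈)   x< =
  contradiction (All.lookup x< y∈) (ℕ.<-asym (All.lookup y< x∈))

sorted-unique : ∀ {m} {L L′ : List (Fin m)} → Sorted L → Sorted L′ →
                (∀ {l} → l ∈ L → l ∈ L′) → (∀ {l} → l ∈ L′ → l ∈ L) → L ≡ L′
sorted-unique []       []         _ _ = ≡.refl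
sorted-unique []       (_ ∷ _)    _ g with () ← g (here ≡.refl)
sorted-unique (_ ∷ _)  []         f _ with () ← f (here ≡.refl)
sorted-unique (x< ∷ S) (y< ∷ S′)  f g
  with ≡.refl ← head∈ y< (f (here ≡.refl)) (g (here ≡.refl)) x< =
  ≡.cong (_ ∷_) (sorted-unique S S′ (tail x< f) (tail y< g))
  where
  tail : ∀ {m} {x : Fin m} {L L′} → All (x Fin.<_) L →
         (∀ {l} → l ∈ x ∷ L → l ∈ x ∷ L′) → ∀ {l} → l ∈ L → l ∈ L′
  tail x< f l∈ with f (there l∈)
  ... | here ≡.refl = contradiction (All.lookup x< l∈) (ℕ.<-irrefl ≡.refl)
  ... | there l∈′   = l∈′

-- There is no index strictly between `j` and `k = j + 1`. In `absorb` this decides whether `wⱼ j`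
-- may grow into `wⱼ k` or `wⱼ k` is already the next factor.
startsWith⊎above : ∀ {m} {j : Fin m} (k : Fin m) L → toℕ k ≡ suc (toℕ j) →
                   All (j Fin.<_) L → Sorted L →
                   (∃[ L′ ] L ≡ k ∷ L′) ⊎ All (k Fin.<_) L
startsWith⊎above k []      _  _        _        = inj₂ []
startsWith⊎above {j = j} k (l ∷ L) eq (j<l ∷ _) (l< ∷ _) with k Fin.≟ l
... | yes ≡.refl = inj₁ (L , ≡.refl)
... | no k≢l     = inj₂ (k<l ∷ All.map (ℕ.<-trans k<l) l<)
  where
  k<l : k Fin.< l
  k<l = ℕ.≤∧≢⇒< (≡.subst (_≤ toℕ l) (≡.sym eq) j<l) (k≢l ∘ Fin.toℕ-injective)

successor : ∀ {m} (k j : Fin m) → k Fin.< j → ∃[ k′ ] toℕ {m} k′ ≡ suc (toℕ k)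
successor k j k<j = fromℕ< k+1<m , Fin.toℕ-fromℕ< k+1<m
  where
  k+1<m : suc (toℕ k) < _
  k+1<m = ℕ.≤-<-trans k<j (Fin.toℕ<n j)

-- The generators as signed permutations

module _ {c ℓ₁ ℓ₂ : Level} (K : HeytingField c ℓ₁ ℓ₂) (2#0 : TwoInvertible K) where

  open TypeB K 2#0
  open Signs
  open Bits using (does-∈?; support-characteristic)
  open HeytingField K using
    (_≈_; -_; refl; sym; trans; -‿cong; reflexive; heytingCommutativeRing)
  open CommutativeRing (HeytingCommutativeRing.commutativeRing heytingCommutativeRing) using (ring)
  open RingProperties ring using (-‿involutive)

  -- The reflection `s k` in coordinates, so that relations between words can be checked on
  -- positions instead of through inner products.
  σ : ∀ {m} → Fin m → V m → V m
  σ zero    v zero    = - v zero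
  σ zero    v (suc l) = v (suc l)
  σ (suc k) v l       = v (τ k l)

  s≈σ : ∀ {m} k (v : V m) l → s k v l ≈ σ k v l
  s≈σ zero v zero    = s-negates v
  s≈σ zero v (suc l) = s-keeps v l
  s≈σ (suc k) v l with l Fin.≟ suc k | l Fin.≟ inject₁ k
  ... | yes ≡.refl | _          = trans (s-swaps₁ v k) (reflexive (≡.cong v (≡.sym (τ-suc k))))
  ... | no _       | yes ≡.refl = trans (s-swaps₂ v k) (reflexive (≡.cong v (≡.sym (τ-inject₁ k))))
  ... | no l≢      | no l≢′     =
    trans (s-other v k l l≢ l≢′) (reflexive (≡.cong v (≡.sym (τ-other k l l≢ l≢′))))

  σ-cong : ∀ {m} k {u v : V m} → (∀ l → u l ≈ v l) → ∀ l → σ k u l ≈ σ k v l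
  σ-cong zero    p zero    = -‿cong (p zero)
  σ-cong zero    p (suc l) = p (suc l)
  σ-cong (suc k) p l       = p (τ k l)

  s-cong : ∀ {m} k {u v : V m} → (∀ l → u l ≈ v l) → ∀ l → s k u l ≈ s k v l
  s-cong k {u} {v} p l = trans (s≈σ k u l) (trans (σ-cong k p l) (sym (s≈σ k v l)))

  ⟦⟧≈σ : ∀ {m} w (v : V m) l → ⟦ w ⟧ v l ≈ foldr σ v w l
  ⟦⟧≈σ []      v l = refl
  ⟦⟧≈σ (k ∷ w) v l = trans (s≈σ k (⟦ w ⟧ v) l) (σ-cong k (⟦⟧≈σ w v) l)

  -- A record, so that u and w can be inferred from a proof of u ≅ w.
  infix 4 _≅_
  record _≅_ {m} (u w : Word m) : Set (c ⊔ ℓ₁) where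
    constructor mk≅
    field on : u ≈ʷ w
  open _≅_

  ≅-refl : ∀ {m} {w : Word m} → w ≅ w
  ≅-refl .on v l = refl

  ≅-sym : ∀ {m} {u w : Word m} → u ≅ w → w ≅ u
  ≅-sym p .on v l = sym (p .on v l)

  ≅-trans : ∀ {m} {u v w : Word m} → u ≅ v → v ≅ w → u ≅ w
  ≅-trans p q .on v l = trans (p .on v l) (q .on v l)

  ≅-reflexive : ∀ {m} {u w : Word m} → u ≡ w → u ≅ w
  ≅-reflexive ≡.refl = ≅-refl

  ≅-setoid : ℕ → Setoid _ _
  ≅-setoid m = record
    { Carrier = Word m ; _≈_ = _≅_
    ; isEquivalence = record { refl = ≅-refl ; sym = ≅-sym ; trans = ≅-trans }
    }

  module ≅-Reasoning {m} = SetoidReasoning (≅-setoid m)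

  ∷-cong : ∀ {m} (k : Fin m) {u w} → u ≅ w → k ∷ u ≅ k ∷ w
  ∷-cong k p .on v = s-cong k (p .on v)

  ++-congˡ : ∀ {m} (x : Word m) {u w} → u ≅ w → x ++ u ≅ x ++ w
  ++-congˡ []      p = p
  ++-congˡ (k ∷ x) p = ∷-cong k (++-congˡ x p)

  ++-congʳ : ∀ {m} (x : Word m) {u w} → u ≅ w → u ++ x ≅ w ++ x
  ++-congʳ x {u} {w} p .on v l
    rewrite List.foldr-++ s v u x | List.foldr-++ s v w x = p .on (⟦ x ⟧ v) l

  fromσ : ∀ {m} (u w : Word m) → (∀ v l → foldr σ v u l ≈ foldr σ v w l) → u ≅ w
  fromσ u w p .on v l = trans (⟦⟧≈σ u v l) (trans (p v l) (sym (⟦⟧≈σ w v l)))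

  -- Coxeter relations

  involutive : ∀ {m} (k : Fin m) w → k ∷ k ∷ w ≅ w
  involutive k w = ++-congʳ w (fromσ (k ∷ k ∷ []) [] (go k))
    where
    go : ∀ {m} (k : Fin m) v l → σ k (σ k v) l ≈ v l
    go zero    v zero    = -‿involutive (v zero)
    go zero    v (suc l) = refl
    go (suc k) v l       = reflexive (≡.cong v (τ-involutive k l))

  commute : ∀ {m} (j k : Fin m) w → suc (toℕ j) < toℕ k → k ∷ j ∷ w ≅ j ∷ k ∷ w
  commute j k w j<k = ++-congʳ w (fromσ (k ∷ j ∷ []) (j ∷ k ∷ []) (go j k j<k))
    where
    go : ∀ {m} (j k : Fin m) → suc (toℕ j) < toℕ k → ∀ v l → σ k (σ j v) l ≈ σ j (σ k v) l
    go zero    (suc zero)    (s≤s ())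
    go zero    (suc (suc k)) _         v zero    = refl
    go zero    (suc (suc k)) _         v (suc l) = refl
    go (suc j) (suc k)       (s≤s j<k) v l       = reflexive (≡.cong v (τ-comm j k j<k l))

  -- Both letters lie in W(A_{m-1}), where the relation reduces to one between transpositions; the
  -- pair s_1, s_2 obeys `braid₄` instead.
  braid : ∀ {m} (k k′ : Fin m) w → 0 < toℕ k → toℕ k′ ≡ suc (toℕ k) →
          k ∷ k′ ∷ k ∷ w ≅ k′ ∷ k ∷ k′ ∷ w
  braid k k′ w 0<k eq = ++-congʳ w (fromσ (k ∷ k′ ∷ k ∷ []) (k′ ∷ k ∷ k′ ∷ []) (go k k′ 0<k eq))
    where
    go : ∀ {m} (k k′ : Fin m) → 0 < toℕ k → toℕ k′ ≡ suc (toℕ k) →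
         ∀ v l → σ k (σ k′ (σ k v)) l ≈ σ k′ (σ k (σ k′ v)) l
    go (suc k) (suc k′) _ eq v l = reflexive (≡.cong v (τ-braid k k′ (ℕ.suc-injective eq) l))

  -- The product s_1 s_2 has order four: both sides negate the first two coordinates and fix the
  -- others.
  braid₄ : ∀ {m} w → suc zero ∷ zero ∷ suc zero ∷ zero ∷ w ≅
                     zero ∷ suc zero ∷ zero ∷ suc {n = suc m} zero ∷ w
  braid₄ w = ++-congʳ w (fromσ
    (suc zero ∷ zero ∷ suc zero ∷ zero ∷ []) (zero ∷ suc zero ∷ zero ∷ suc zero ∷ [])
    λ { v zero → refl ; v (suc zero) → refl ; v (suc (suc l)) → refl })

  reverse-inverse : ∀ {m} (p : Word m) → p ++ reverse p ≅ []
  reverse-inverse []      = ≅-refl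
  reverse-inverse (k ∷ p) = begin
    k ∷ p ++ reverse (k ∷ p)      ≡⟨ ≡.cong (λ q → k ∷ p ++ q) (List.unfold-reverse k p) ⟩
    k ∷ p ++ reverse p ++ [ k ]   ≡⟨ ≡.cong (k ∷_) (List.++-assoc p (reverse p) [ k ]) ⟨
    k ∷ (p ++ reverse p) ++ [ k ] ≈⟨ ∷-cong k (++-congʳ [ k ] (reverse-inverse p)) ⟩
    k ∷ k ∷ []                    ≈⟨ involutive k [] ⟩
    []                            ∎
    where open ≅-Reasoning

  slide : ∀ {m} {k k′ : Fin m} {w} x → k ∷ w ≅ w ++ [ k′ ] → k ∷ w ++ x ≅ w ++ k′ ∷ x
  slide {k′ = k′} {w} x p = ≅-trans (++-congʳ x p) (≅-reflexive (List.++-assoc w [ k′ ] x))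

  -- Moving letters past the words w_j

  wⱼ-suc : ∀ {m} (k′ k : Fin m) → toℕ k′ ≡ suc (toℕ k) → wⱼ k′ ≡ k′ ∷ wⱼ k
  wⱼ-suc k′ k eq = ≡.trans (wⱼ-step k′) (≡.cong (λ t → k′ ∷ descending t) eq)

  wⱼ-suc-inject₁ : ∀ {m} (k : Fin m) → wⱼ (suc k) ≡ suc k ∷ wⱼ (inject₁ k)
  wⱼ-suc-inject₁ k = wⱼ-suc (suc k) (inject₁ k) (≡.cong suc (≡.sym (Fin.toℕ-inject₁ k)))

  -- Every letter of `wⱼ j` is at most `j`, hence at distance at least two from `k`.
  wⱼ-commute : ∀ {m} (j k : Fin m) → suc (toℕ j) < toℕ k → k ∷ wⱼ j ≅ wⱼ j ++ [ k ]
  wⱼ-commute {suc m} j k = <-weakInduction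
    (λ j → suc (toℕ j) < toℕ k → k ∷ wⱼ j ≅ wⱼ j ++ [ k ])
    (λ 1<k → ≅-trans (++-congˡ [ k ] (≅-reflexive (wⱼ-step zero)))
       (≅-trans (commute zero k [] 1<k)
         (≅-reflexive (≡.cong (_++ [ k ]) (≡.sym (wⱼ-step (zero {n = m})))))))
    step j
    where
    step : ∀ i → (suc (toℕ (inject₁ i)) < toℕ k → k ∷ wⱼ (inject₁ i) ≅ wⱼ (inject₁ i) ++ [ k ]) →
           suc (toℕ (suc i)) < toℕ k → k ∷ wⱼ (suc i) ≅ wⱼ (suc i) ++ [ k ]
    step i ih i<k rewrite wⱼ-suc-inject₁ i = ≅-trans (commute (suc i) k _ i<k)
      (∷-cong (suc i) (ih (≡.subst (λ t → suc t < toℕ k) (≡.sym (Fin.toℕ-inject₁ i)) (ℕ.<⇒≤ i<k))))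

  -- The letter `k` commutes with the letters of `wⱼ j` above `k′`. At `k′ k` a braid relation turns
  -- it into `k′`, which commutes with all the letters below `k`.
  wⱼ-shift : ∀ {m} (j k k′ : Fin m) → 0 < toℕ k → toℕ k′ ≡ suc (toℕ k) → k′ Fin.≤ j →
             k ∷ wⱼ j ≅ wⱼ j ++ [ k′ ]
  wⱼ-shift {suc m} j (suc k) k′ 0<k eq = <-weakInduction
    (λ j → k′ Fin.≤ j → suc k ∷ wⱼ j ≅ wⱼ j ++ [ k′ ])
    (λ k′≤0 → contradiction (≡.subst (_≤ 0) eq k′≤0) (λ ()))
    step j
    where
    step : ∀ i → (k′ Fin.≤ inject₁ i → suc k ∷ wⱼ (inject₁ i) ≅ wⱼ (inject₁ i) ++ [ k′ ]) →
           k′ Fin.≤ suc i → suc k ∷ wⱼ (suc i) ≅ wⱼ (suc i) ++ [ k′ ]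
    step i ih k′≤j with ℕ.m≤n⇒m<n∨m≡n k′≤j
    ... | inj₁ (s≤s k′≤i) rewrite wⱼ-suc-inject₁ i = ≅-trans
      (≅-sym (commute (suc k) (suc i) _ (s≤s (≡.subst (_≤ toℕ i) eq k′≤i))))
      (∷-cong (suc i) (ih (≡.subst (toℕ k′ ≤_) (≡.sym (Fin.toℕ-inject₁ i)) k′≤i)))
    ... | inj₂ k′≡j with ≡.refl ← Fin.toℕ-injective k′≡j
        rewrite wⱼ-suc (suc i) (suc k) eq | wⱼ-suc-inject₁ k = ≅-trans
      (braid (suc k) k′ _ 0<k eq)
      (∷-cong k′ (∷-cong (suc k) (wⱼ-commute (inject₁ k) k′
        (≡.subst₂ _<_ (≡.cong suc (≡.sym (Fin.toℕ-inject₁ k))) (≡.sym eq) (ℕ.n<1+n _)))))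

  -- Resolves a repeated factor. Induction on the index: the leading letter of the second copy moves
  -- left, a braid relation exposes the square of the shorter word, and the smallest case is
  -- `braid₄`.
  wⱼ-square : ∀ {m} (j′ j : Fin (suc (suc m))) → toℕ j ≡ suc (toℕ j′) →
              wⱼ j ++ wⱼ j ≅ wⱼ j′ ++ wⱼ j ++ [ suc zero ]
  wⱼ-square {m} = <-weakInduction
    (λ j′ → ∀ j → toℕ j ≡ suc (toℕ j′) → wⱼ j ++ wⱼ j ≅ wⱼ j′ ++ wⱼ j ++ [ suc zero ])
    base step
    where
    base : ∀ j → toℕ j ≡ 1 → wⱼ j ++ wⱼ j ≅ wⱼ zero ++ wⱼ j ++ [ suc zero ]
    base (suc zero) _ rewrite wⱼ-suc-inject₁ (zero {n = m}) | wⱼ-step (zero {n = suc m}) = braid₄ []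

    step : ∀ i → (∀ j → toℕ j ≡ suc (toℕ (inject₁ i)) →
                    wⱼ j ++ wⱼ j ≅ wⱼ (inject₁ i) ++ wⱼ j ++ [ suc zero ]) →
           ∀ j → toℕ j ≡ suc (toℕ (suc i)) → wⱼ j ++ wⱼ j ≅ wⱼ (suc i) ++ wⱼ j ++ [ suc zero ]
    step i ih j eq with rec ← ih (suc i) (≡.cong suc (≡.sym (Fin.toℕ-inject₁ i)))
      rewrite wⱼ-suc j (suc i) eq | wⱼ-suc-inject₁ i = begin
      j ∷ k ∷ W ++ j ∷ k ∷ W             ≈⟨ ∷-cong j (∷-cong k (slide (k ∷ W) far)) ⟨
      j ∷ k ∷ j ∷ W ++ k ∷ W             ≈⟨ braid k j _ z<s eq ⟨
      k ∷ j ∷ k ∷ W ++ k ∷ W             ≈⟨ ∷-cong k (∷-cong j rec) ⟩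
      k ∷ j ∷ W ++ k ∷ W ++ [ suc zero ] ≈⟨ ∷-cong k (slide (k ∷ W ++ [ suc zero ]) far) ⟩
      k ∷ W ++ j ∷ k ∷ W ++ [ suc zero ] ∎
      where
      open ≅-Reasoning
      k = suc i
      W = wⱼ (inject₁ i)
      far : j ∷ W ≅ W ++ [ j ]
      far = wⱼ-commute (inject₁ i) j
        (≡.subst₂ _<_ (≡.cong suc (≡.sym (Fin.toℕ-inject₁ i))) (≡.sym eq) (ℕ.n<1+n _))

  -- Two consecutive indices force `m ≥ 2`, so the letter s_2 exists; for an arbitrary `m` it has to
  -- be returned as a witness.
  wⱼ-square-one : ∀ {m} (j′ j : Fin m) → toℕ j ≡ suc (toℕ j′) →
                  ∃[ one ] toℕ {m} one ≡ 1 × wⱼ j ++ wⱼ j ≅ wⱼ j′ ++ wⱼ j ++ [ one ]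
  wⱼ-square-one {suc zero}    zero zero ()
  wⱼ-square-one {suc (suc m)} j′   j    eq = suc zero , ≡.refl , wⱼ-square j′ j eq

  -- Normal forms

  -- Each factor raises the letter by one through `wⱼ-shift`. The raised letter is at most the index
  -- `j` just passed, hence still below the rest of the strictly increasing list.
  canonical-shift : ∀ {m} (k : Fin m) L → 0 < toℕ k → All (k Fin.<_) L → Sorted L →
                    ∃[ k′ ] 0 < toℕ k′ × k ∷ ⌊ L ⌋ ≅ ⌊ L ⌋ ++ [ k′ ]
  canonical-shift k []      0<k _         _        = k , 0<k , ≅-refl
  canonical-shift k (j ∷ L) 0<k (k<j ∷ _) (j< ∷ S)
    with k′ , eq ← successor k j k<j
    with k′≤j ← ≡.subst (_≤ toℕ j) (≡.sym eq) k<j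
    with k″ , 0<k″ , p ← canonical-shift k′ L (≡.subst (0 <_) (≡.sym eq) z<s)
           (All.map (ℕ.≤-<-trans k′≤j) j<) S =
    k″ , 0<k″ , (begin
      k ∷ wⱼ j ++ ⌊ L ⌋          ≈⟨ slide ⌊ L ⌋ (wⱼ-shift j k k′ 0<k eq k′≤j) ⟩
      wⱼ j ++ k′ ∷ ⌊ L ⌋         ≈⟨ ++-congˡ (wⱼ j) p ⟩
      wⱼ j ++ ⌊ L ⌋ ++ [ k″ ]    ≡⟨ List.++-assoc (wⱼ j) ⌊ L ⌋ [ k″ ] ⟨
      (wⱼ j ++ ⌊ L ⌋) ++ [ k″ ]  ∎)
    where open ≅-Reasoning

  -- Covers both outcomes of left multiplication by a generator: a new list with `p` empty, or the
  -- old list with one letter of W(A_{m-1}) in `p`.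
  record Absorbed {m} (k : Fin m) (L : List (Fin m)) : Set (c ⊔ ℓ₁) where
    field
      {L′}      : List (Fin m)
      {p}       : Word m
      sorted    : Sorted L′
      aword     : AWord p
      equal     : k ∷ ⌊ L ⌋ ≅ ⌊ L′ ⌋ ++ p
      shortened : length ⌊ L′ ⌋ + length p ≤ suc (length ⌊ L ⌋)
      -- Keeps the letter in front of L below L′ when k commutes with it.
      bounded   : ∀ (b : Fin m) → suc (toℕ b) < toℕ k → All (b Fin.<_) L → All (b Fin.<_) L′

  module _ {m} {k : Fin m} {L : List (Fin m)} where

    -- The word stays the same letter by letter; only its division into factors is new.
    extend : ∀ {L′} → Sorted L′ → k ∷ ⌊ L ⌋ ≡ ⌊ L′ ⌋ →
             (∀ (b : Fin m) → suc (toℕ b) < toℕ k → All (b Fin.<_) L → All (b Fin.<_) L′) →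
             Absorbed k L
    extend S eq bounded = record
      { sorted    = S
      ; aword     = []
      ; equal     = ≅-reflexive (≡.trans eq (≡.sym (List.++-identityʳ _)))
      ; shortened = ℕ.≤-reflexive (≡.trans (ℕ.+-identityʳ _) (≡.cong length (≡.sym eq)))
      ; bounded   = bounded
      }

    cancelHead : ∀ {L′} → Sorted L′ → ⌊ L ⌋ ≡ k ∷ ⌊ L′ ⌋ →
                 (∀ (b : Fin m) → suc (toℕ b) < toℕ k → All (b Fin.<_) L → All (b Fin.<_) L′) →
                 Absorbed k L
    cancelHead {L′} S eq bounded = record
      { sorted    = S
      ; aword     = []
      ; equal     = ≅-trans (∷-cong k (≅-reflexive eq))
          (≅-trans (involutive k ⌊ L′ ⌋) (≅-reflexive (≡.sym (List.++-identityʳ _))))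
      ; shortened = ≡.subst (λ w → length ⌊ L′ ⌋ + 0 ≤ suc (length w)) (≡.sym eq)
          (≡.subst (_≤ suc (suc (length ⌊ L′ ⌋))) (≡.sym (ℕ.+-identityʳ _))
            (ℕ.m≤n⇒m≤1+n (ℕ.n≤1+n _)))
      ; bounded   = bounded
      }

    pass : ∀ {k′} → Sorted L → 0 < toℕ k′ → k ∷ ⌊ L ⌋ ≅ ⌊ L ⌋ ++ [ k′ ] → Absorbed k L
    pass S 0<k′ p = record
      { sorted    = S
      ; aword     = 0<k′ ∷ []
      ; equal     = p
      ; shortened = ℕ.≤-reflexive (ℕ.+-comm _ 1)
      ; bounded   = λ _ _ b< → b<
      }

  -- Compare `k` with the leading index `j`. Below `j`, s_1 opens a new factor and any other letter
  -- passes through; at `j` it cancels; at `j + 1` it lengthens the factor or meets a repetition;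
  -- beyond that it commutes with the factor and recursion applies.
  absorb : ∀ {m} (k : Fin m) L → Sorted L → Absorbed k L
  absorb {suc m} zero [] S =
    extend {L′ = [ zero ]} ([] ∷ []) (≡.cong (_++ []) (≡.sym (wⱼ-step (zero {n = m})))) (λ _ ())
  absorb (suc k) [] S = pass S z<s ≅-refl
  absorb k (j ∷ L) S@(j< ∷ S′) with Fin.<-cmp k j
  absorb {suc m} zero (j ∷ L) S@(j< ∷ S′) | tri< 0<j _ _ =
    extend ((0<j ∷ All.map (ℕ.<-trans 0<j) j<) ∷ S)
      (≡.cong (_++ ⌊ j ∷ L ⌋) (≡.sym (wⱼ-step (zero {n = m})))) (λ _ ())
  absorb (suc k) (j ∷ L) S@(j< ∷ S′) | tri< k<j _ _
    with k′ , 0<k′ , p ← canonical-shift (suc k) (j ∷ L) z<s (k<j ∷ All.map (ℕ.<-trans k<j) j<) S =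
    pass S 0<k′ p
  -- The factor is the single letter s_1, so it disappears altogether.
  absorb {suc m} zero (.zero ∷ L) (j< ∷ S′) | tri≈ _ ≡.refl _ =
    cancelHead S′ (≡.cong (_++ ⌊ L ⌋) (wⱼ-step (zero {n = m}))) (λ _ ())
  absorb (suc k) (.(suc k) ∷ L) (j< ∷ S′) | tri≈ _ ≡.refl _ =
    cancelHead {L′ = inject₁ k ∷ L} (All.map (ℕ.<-trans k′<k) j< ∷ S′)
      (≡.cong (_++ ⌊ L ⌋) (wⱼ-suc-inject₁ k))
      -- The leading index drops by one, and `b + 1 < k` leaves exactly enough room for that.
      (λ { b (s≤s b<k) (_ ∷ b<) → ≡.subst (toℕ b <_) (≡.sym (Fin.toℕ-inject₁ k)) b<k ∷ b< })
    where
    k′<k : toℕ (inject₁ k) < suc (toℕ k)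
    k′<k = s≤s (ℕ.≤-reflexive (Fin.toℕ-inject₁ k))
  absorb k (j ∷ L) S@(j< ∷ S′) | tri> _ _ j<k with ℕ.m≤n⇒m<n∨m≡n j<k
  ... | inj₁ j+1<k = record
      { sorted    = bounded j j+1<k j< ∷ sorted
      ; aword     = aword
      ; equal     = begin
          k ∷ wⱼ j ++ ⌊ L ⌋       ≈⟨ slide ⌊ L ⌋ (wⱼ-commute j k j+1<k) ⟩
          wⱼ j ++ k ∷ ⌊ L ⌋       ≈⟨ ++-congˡ (wⱼ j) equal ⟩
          wⱼ j ++ ⌊ L′ ⌋ ++ p     ≡⟨ List.++-assoc (wⱼ j) ⌊ L′ ⌋ p ⟨
          (wⱼ j ++ ⌊ L′ ⌋) ++ p   ∎
      ; shortened = shortened′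
      ; bounded   = λ { b b<k (b<j ∷ b<) → b<j ∷ bounded b b<k b< }
      }
    where
    open Absorbed (absorb k L S′)
    open ≅-Reasoning
    shortened′ : length (wⱼ j ++ ⌊ L′ ⌋) + length p ≤ suc (length (wⱼ j ++ ⌊ L ⌋))
    shortened′ rewrite List.length-++ (wⱼ j) {⌊ L′ ⌋} | List.length-++ (wⱼ j) {⌊ L ⌋}
      | ℕ.+-assoc (length (wⱼ j)) (length ⌊ L′ ⌋) (length p)
      | ≡.sym (ℕ.+-suc (length (wⱼ j)) (length ⌊ L ⌋)) = ℕ.+-monoʳ-≤ (length (wⱼ j)) shortened
  ... | inj₂ j+1≡k with startsWith⊎above k L (≡.sym j+1≡k) j< S′
  ...   | inj₂ k< = extend (k< ∷ S′) (≡.cong (_++ ⌊ L ⌋) (≡.sym (wⱼ-suc k j (≡.sym j+1≡k))))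
      (λ { b b<k (_ ∷ b<) → ℕ.<⇒≤ b<k ∷ b< })
  -- Here `k` completes `wⱼ j` to a second copy of `wⱼ k`. The square relation restores both factors
  -- and emits s_2, whose index is at most `k`, so that it passes through the factors in `L″`.
  ...   | inj₁ (L″ , ≡.refl)
    with k< ∷ S″ ← S′
    with one , one≡1 , square ← wⱼ-square-one j k (≡.sym j+1≡k)
    with k′ , 0<k′ , p ← canonical-shift one L″ (≡.subst (0 <_) (≡.sym one≡1) z<s)
           (All.map (ℕ.≤-<-trans (≡.subst₂ _≤_ (≡.sym one≡1) j+1≡k (s≤s z≤n))) k<) S″ =
    pass S 0<k′ (begin
      k ∷ wⱼ j ++ wⱼ k ++ ⌊ L″ ⌋             ≡⟨ ≡.cong (_++ wⱼ k ++ ⌊ L″ ⌋) (wⱼ-suc k j (≡.sym j+1≡k)) ⟨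
      wⱼ k ++ wⱼ k ++ ⌊ L″ ⌋                 ≡⟨ List.++-assoc (wⱼ k) (wⱼ k) ⌊ L″ ⌋ ⟨
      (wⱼ k ++ wⱼ k) ++ ⌊ L″ ⌋               ≈⟨ ++-congʳ ⌊ L″ ⌋ square ⟩
      (wⱼ j ++ wⱼ k ++ [ one ]) ++ ⌊ L″ ⌋    ≡⟨ List.++-assoc (wⱼ j) _ ⌊ L″ ⌋ ⟩
      wⱼ j ++ (wⱼ k ++ [ one ]) ++ ⌊ L″ ⌋    ≡⟨ ≡.cong (wⱼ j ++_) (List.++-assoc (wⱼ k) _ ⌊ L″ ⌋) ⟩
      wⱼ j ++ wⱼ k ++ one ∷ ⌊ L″ ⌋           ≈⟨ ++-congˡ (wⱼ j) (++-congˡ (wⱼ k) p) ⟩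
      wⱼ j ++ wⱼ k ++ ⌊ L″ ⌋ ++ [ k′ ]       ≡⟨ ≡.cong (wⱼ j ++_) (List.++-assoc (wⱼ k) ⌊ L″ ⌋ [ k′ ]) ⟨
      wⱼ j ++ (wⱼ k ++ ⌊ L″ ⌋) ++ [ k′ ]     ≡⟨ List.++-assoc (wⱼ j) _ [ k′ ] ⟨
      (wⱼ j ++ wⱼ k ++ ⌊ L″ ⌋) ++ [ k′ ]     ∎)
    where open ≅-Reasoning

  NormalForm : ∀ {m} → List (Fin m) → Word m → Set (c ⊔ ℓ₁)
  NormalForm L u = ∃[ p ] AWord p × u ≅ ⌊ L ⌋ ++ p × length ⌊ L ⌋ + length p ≤ length u

  -- Letters are absorbed from right to left; each emitted letter of W(A_{m-1}) is collected in
  -- front of the earlier ones, and `shortened` bounds the total length.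
  normalise : ∀ {m} (u : Word m) → ∃[ L ] Sorted L × NormalForm L u
  normalise []      = [] , [] , [] , [] , ≅-refl , z≤n
  normalise (k ∷ u) with L , S , p , a , eq , short ← normalise u =
    L′ , sorted , q ++ p , All.++⁺ aword a ,
    (begin
      k ∷ u                ≈⟨ ∷-cong k eq ⟩
      k ∷ ⌊ L ⌋ ++ p       ≈⟨ ++-congʳ p equal ⟩
      (⌊ L′ ⌋ ++ q) ++ p   ≡⟨ List.++-assoc ⌊ L′ ⌋ q p ⟩
      ⌊ L′ ⌋ ++ q ++ p     ∎) ,
    short′
    where
    open Absorbed (absorb k L S) renaming (p to q)
    open ≅-Reasoning
    short′ : length ⌊ L′ ⌋ + length (q ++ p) ≤ suc (length u)
    short′ rewrite List.length-++ q {p} | ≡.sym (ℕ.+-assoc (length ⌊ L′ ⌋) (length q) (length p)) =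
      ℕ.≤-trans (ℕ.+-monoˡ-≤ (length p) shortened) (s≤s short)

  -- Sign vectors

  act-τ : ∀ {m} (k : Fin m) (A : Sign (suc m)) → act (suc k) A ≗ A ∘ τ k
  act-τ k A l with l Fin.≟ suc k | l Fin.≟ inject₁ k
  ... | yes ≡.refl | _          = ≡.cong A (≡.sym (τ-suc k))
  ... | no _       | yes ≡.refl = ≡.cong A (≡.sym (τ-inject₁ k))
  ... | no l≢      | no l≢′     = ≡.cong A (≡.sym (τ-other k l l≢ l≢′))

  act-cong : ∀ {m} (k : Fin m) {A B : Sign m} → A ≗ B → act k A ≗ act k B
  act-cong zero    eq zero    = ≡.cong not (eq zero)
  act-cong zero    eq (suc l) = eq (suc l)
  act-cong (suc k) {A} {B} eq l =
    ≡.trans (act-τ k A l) (≡.trans (eq (τ k l)) (≡.sym (act-τ k B l)))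

  ⟪⟫-cong : ∀ {m} (w : Word m) {A B : Sign m} → A ≗ B → ⟪ w ⟫ A ≗ ⟪ w ⟫ B
  ⟪⟫-cong []      eq = eq
  ⟪⟫-cong (k ∷ w) eq = act-cong k (⟪⟫-cong w eq)

  sign : ∀ {m} → Word m → Sign m
  sign w = ⟪ w ⟫ allOff

  -- Equal maps agree on (1, ..., 1), and the signs can be read off from the image because 1 and -1
  -- differ.
  sign-cong : ∀ {m} (u w : Word m) → u ≅ w → sign u ≗ sign w
  sign-cong u w p l = ±-injective
    (trans (sym (⟦⟧-± u allOff l)) (trans (p .on (± ∘ allOff) l) (⟦⟧-± w allOff l)))

  sign-AWord : ∀ {m} {p : Word m} → AWord p → sign p ≗ allOff
  sign-AWord []                    l = ≡.refl
  sign-AWord {p = suc k ∷ p} (_ ∷ a) l = ≡.trans (act-τ k (sign p) l) (sign-AWord a (τ k l))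

  sign-++-AWord : ∀ {m} (u : Word m) {p} → AWord p → sign (u ++ p) ≗ sign u
  sign-++-AWord u {p} a l =
    ≡.trans (≡.cong (λ A → A l) (⟪⟫-++ u p allOff)) (⟪⟫-cong u (sign-AWord a) l)

  -- By `marks`, membership in a sorted list is visible in the sign vector of its word.
  sign-sorted : ∀ {m} {L L′ : List (Fin m)} → Sorted L → Sorted L′ →
                (∀ l → sign ⌊ L ⌋ l ≡ sign ⌊ L′ ⌋ l) → L ≡ L′
  sign-sorted {m} S S′ eq = sorted-unique S S′ (⊆ S S′ eq) (⊆ S′ S (≡.sym ∘ eq))
    where
    open DecMembership (Fin._≟_ {m}) renaming (_∈?_ to _∈ˡ?_) using ()

    ⊆ : ∀ {L L′ : List (Fin m)} → Sorted L → Sorted L′ → (∀ l → sign ⌊ L ⌋ l ≡ sign ⌊ L′ ⌋ l) →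
        ∀ {l} → l ∈ L → l ∈ L′
    ⊆ {L} {L′} S S′ eq {l} l∈ with l ∈ˡ? L′
    ... | yes l∈′ = l∈′
    ... | no l∉′ with () ←
          ≡.trans (≡.sym (proj₁ (marks L S l) l∈)) (≡.trans (eq l) (proj₂ (marks L′ S′ l) l∉′))

  -- Minimal coset representatives

  module Representatives {m} (J : Subset m) where

    -- The factor from W(A_{m-1}) leaves the signs alone, so the list produced by `normalise` has
    -- the signs of `wᴶ J` and must be `elements J`.
    normalForm : ∀ u → sign u ≗ sign (wᴶ J) → NormalForm (elements J) u
    normalForm u eq with L , S , nf@(p , a , u≅ , _) ← normalise u
      with ≡.refl ← sign-sorted S (AllPairs.filter⁺ (_∈? J) (AllPairs.tabulate⁺-< id))
             (λ l → ≡.trans (≡.sym (≡.trans (sign-cong u _ u≅ l) (sign-++-AWord ⌊ L ⌋ a l))) (eq l)) = nf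

    length-minimal : ∀ u → sign u ≗ sign (wᴶ J) → length (wᴶ J) ≤ length u
    length-minimal u eq with p , _ , _ , short ← normalForm u eq = ℕ.m+n≤o⇒m≤o _ short

    isLength : ∀ {u} → u ≅ wᴶ J → IsLength u (length (wᴶ J))
    isLength p = (wᴶ J , ≅-sym p .on , ≡.refl) ,
      λ u′ u′≈u → length-minimal u′ (sign-cong u′ (wᴶ J) (≅-trans (mk≅ u′≈u) p))

    module _ (x : Word m) (x-sign : sign x ≗ sign (wᴶ J)) where

      ∈[x]-sign : ∀ u → u ∈[ x ] → sign u ≗ sign (wᴶ J)
      ∈[x]-sign u (p , a , eq) l =
        ≡.trans (sign-cong u (x ++ p) (mk≅ eq) l) (≡.trans (sign-++-AWord x a l) (x-sign l))

      -- Solve `x ≅ wᴶ J ++ p` for `wᴶ J`; reversing `p` inverts it, since the generators are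
      -- involutions.
      ≅wᴶ⇒∈[x] : ∀ {u} → u ≅ wᴶ J → u ∈[ x ]
      ≅wᴶ⇒∈[x] {u} u≅ with p , a , x≅ , _ ← normalForm x x-sign =
        reverse p , AWord-reverse a , (begin
          u                          ≈⟨ u≅ ⟩
          wᴶ J                       ≡⟨ List.++-identityʳ (wᴶ J) ⟨
          wᴶ J ++ []                 ≈⟨ ++-congˡ (wᴶ J) (reverse-inverse p) ⟨
          wᴶ J ++ p ++ reverse p     ≡⟨ List.++-assoc (wᴶ J) p (reverse p) ⟨
          (wᴶ J ++ p) ++ reverse p   ≈⟨ ++-congʳ (reverse p) x≅ ⟨
          x ++ reverse p             ∎) .on
        where open ≅-Reasoning

      minimal⇒≅wᴶ : ∀ {u} → IsMinimalRepresentative x u → u ≅ wᴶ J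
      minimal⇒≅wᴶ {u} (u∈ , k , ((u′ , u′≈u , ≡.refl) , _) , k≤)
        with normalForm u′ (λ l → ≡.trans (sign-cong u′ u (mk≅ u′≈u) l) (∈[x]-sign u u∈ l))
      ... | []    , _ , u′≅ , _     =
        ≅-trans (≅-sym (mk≅ u′≈u)) (≅-trans u′≅ (≅-reflexive (List.++-identityʳ _)))
      -- A nonempty remainder would make `u′`, a shortest word for `u`, longer than `wᴶ J`, which
      -- lies in the same coset.
      ... | _ ∷ p , _ , _   , short = contradiction
        (ℕ.≤-trans short (k≤ (wᴶ J) _ (≅wᴶ⇒∈[x] ≅-refl) (isLength ≅-refl)))
        (ℕ.m+1+n≰m _)

      ≅wᴶ⇒minimal : ∀ {u} → u ≅ wᴶ J → IsMinimalRepresentative x u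
      ≅wᴶ⇒minimal p = ≅wᴶ⇒∈[x] p , _ , isLength p ,
        λ { u′ k′ u′∈ ((u″ , u″≈u′ , ≡.refl) , _) →
            length-minimal u″ (λ l → ≡.trans (sign-cong u″ u′ (mk≅ u″≈u′) l) (∈[x]-sign u′ u′∈ l)) }

  -- Signs of the inserted words

  sign-++ : ∀ {m} (u w : Word m) {A} → sign w ≗ A → sign (u ++ w) ≗ ⟪ u ⟫ A
  sign-++ u w eq l = ≡.trans (≡.cong (λ A → A l) (⟪⟫-++ u w allOff)) (⟪⟫-cong u eq l)

  act-inject₁ : ∀ {m} (k : Fin m) A b →
                act (inject₁ k) (insertᶠ A (fromℕ m) b) ≗ insertᶠ (act k A) (fromℕ m) b
  act-inject₁ zero    A b zero    = ≡.refl
  act-inject₁ zero    A b (suc l) = ≡.refl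
  act-inject₁ (suc k) A b l = ≡.trans (act-τ (inject₁ k) _ l) (≡.trans (τ-insertAt-last A k b l)
    (insertAt-cong (≡.sym ∘ act-τ k A) (fromℕ _) b l))

  -- The letters of `ι w` do not move the last coordinate, which keeps its initial sign +.
  sign-ι : ∀ {n} (w : Word n) → sign (ι w) ≗ insertᶠ (sign w) (fromℕ n) false
  sign-ι []      l = ≡.sym (insertAt-replicate false (fromℕ _) l)
  sign-ι (k ∷ w) l = ≡.trans (act-cong (inject₁ k) (sign-ι w) l) (act-inject₁ k (sign w) false l)

  -- Downward induction from the empty word at `i = n`: each letter added on the left moves the
  -- inserted entry one place to the left.
  ascending-inserts : ∀ {n} (A : Sign n) b i →
                      ⟪ drop (suc (toℕ i)) (allFin (suc n)) ⟫ (insertᶠ A (fromℕ n) b) ≗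
                      insertᶠ A i b
  ascending-inserts {n} A b = >-weakInduction
    (λ i → ⟪ drop (suc (toℕ i)) (allFin (suc n)) ⟫ (insertᶠ A (fromℕ n) b) ≗ insertᶠ A i b)
    base step
    where
    base : ⟪ drop (suc (toℕ (fromℕ n))) (allFin (suc n)) ⟫ (insertᶠ A (fromℕ n) b) ≗
           insertᶠ A (fromℕ n) b
    base l rewrite List.drop-all (suc (toℕ (fromℕ n))) (allFin (suc n))
      (ℕ.≤-reflexive (≡.trans (List.length-tabulate {n = suc n} id)
        (≡.cong suc (≡.sym (Fin.toℕ-fromℕ n))))) = ≡.refl

    step : ∀ i → ⟪ drop (suc (suc (toℕ i))) (allFin (suc n)) ⟫ (insertᶠ A (fromℕ n) b) ≗
             insertᶠ A (suc i) b →
           ⟪ drop (suc (toℕ (inject₁ i))) (allFin (suc n)) ⟫ (insertᶠ A (fromℕ n) b) ≗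
             insertᶠ A (inject₁ i) b
    step i ih l rewrite Fin.toℕ-inject₁ i | drop-tabulate {m = suc n} id (suc i) =
      ≡.trans (act-cong (suc i) ih l) (≡.trans (act-τ i _ l) (τ-insertAt-down A i b l))

  -- The rightmost letter s_1 negates the entry at the front; each later letter moves it one place
  -- to the right.
  wⱼ-inserts : ∀ {n} (A : Sign n) b i → ⟪ wⱼ i ⟫ (insertᶠ A zero b) ≗ insertᶠ A i (not b)
  wⱼ-inserts {n} A b = <-weakInduction
    (λ i → ⟪ wⱼ i ⟫ (insertᶠ A zero b) ≗ insertᶠ A i (not b))
    base step
    where
    base : ⟪ wⱼ zero ⟫ (insertᶠ A zero b) ≗ insertᶠ A zero (not b)
    base l rewrite wⱼ-step (zero {n = n}) with l
    ... | zero  = ≡.refl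
    ... | suc _ = ≡.refl

    step : ∀ i → ⟪ wⱼ (inject₁ i) ⟫ (insertᶠ A zero b) ≗ insertᶠ A (inject₁ i) (not b) →
           ⟪ wⱼ (suc i) ⟫ (insertᶠ A zero b) ≗ insertᶠ A (suc i) (not b)
    step i ih l rewrite wⱼ-suc-inject₁ i =
      ≡.trans (act-cong (suc i) ih l) (≡.trans (act-τ i _ l) (τ-insertAt-up A i (not b) l))

  isOne : Bit → Bool
  isOne b = does (b Fin.≟ 1b)

  𝓘-inserts : ∀ n i b (A : Sign n) →
              ⟪ 𝓘 n (i′ n i b) ⟫ (insertᶠ A (fromℕ n) false) ≗ insertᶠ A i (isOne b)
  𝓘-inserts n i zero A l rewrite 𝓘-0b n i = ascending-inserts A false i l
  𝓘-inserts n i (suc zero) A l rewrite 𝓘-1b n i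
    | ⟪⟫-++ (wⱼ i) (drop 1 (allFin (suc n))) (insertᶠ A (fromℕ n) false) =
    ≡.trans (⟪⟫-cong (wⱼ i) (ascending-inserts A false zero) l) (wⱼ-inserts A false i l)

  does-∈?-support : ∀ {m} (x : Vec Bit m) l → does (l ∈? support x) ≡ isOne (lookup x l)
  does-∈?-support x l = ≡.trans (does-∈? (support x) l) (Vec.lookup∘tabulate (isOne ∘ lookup x) l)

  isOne-characteristic : ∀ {m} (J : Subset m) l → isOne (lookup (characteristic J) l) ≡ does (l ∈? J)
  isOne-characteristic J l = ≡.trans (≡.sym (does-∈?-support (characteristic J) l))
    (≡.cong (λ J → does (l ∈? J)) (support-characteristic J))

  -- This is the hypothesis on `x` in `Representatives`, with the subset whose bits are those of `J`
  -- after insertion.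
  sign-𝓘-ι : ∀ {n} i b w (J : Subset n) → w ≅ wᴶ J →
             sign (𝓘 n (i′ n i b) ++ ι w) ≗ sign (wᴶ (support (insertAt (characteristic J) i b)))
  sign-𝓘-ι {n} i b w J w≅ l = begin
    sign (𝓘 n (i′ n i b) ++ ι w) l
      ≡⟨ sign-++ (𝓘 n (i′ n i b)) (ι w) (sign-ι w) l ⟩
    ⟪ 𝓘 n (i′ n i b) ⟫ (insertᶠ (sign w) (fromℕ n) false) l
      ≡⟨ 𝓘-inserts n i b (sign w) l ⟩
    insertᶠ (sign w) i (isOne b) l
      ≡⟨ insertAt-cong sign-w i (isOne b) l ⟩
    insertᶠ (isOne ∘ lookup (characteristic J)) i (isOne b) l
      ≡⟨ lookup-insertAt isOne (characteristic J) i b l ⟨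
    isOne (lookup (insertAt (characteristic J) i b) l)
      ≡⟨ does-∈?-support (insertAt (characteristic J) i b) l ⟨
    does (l ∈? support (insertAt (characteristic J) i b))
      ≡⟨ wᴶ-sign (support (insertAt (characteristic J) i b)) l ⟨
    sign (wᴶ (support (insertAt (characteristic J) i b))) l ∎
    where
    open ≡.≡-Reasoning
    sign-w : sign w ≗ isOne ∘ lookup (characteristic J)
    sign-w k = ≡.trans (sign-cong w (wᴶ J) w≅ k) (≡.trans (wᴶ-sign J k) (≡.sym (isOne-characteristic J k)))

theorem4p4 : ∀ {c ℓ₁ ℓ₂} (K : HeytingField c ℓ₁ ℓ₂) →
    (2#0 : TwoInvertible K) →
    let open TypeB K 2#0 in
    (n : ℕ) → 2 ≤ n →
    (i : Fin (suc n)) (b : Bit) →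
    (w : Setoid.Carrier (𝓜 n)) (u : Word (suc n)) →
    (𝓘 n (i′ n i b) ∙ ι (proj₁ w) ↦ u)
    ⇔ (u ≈ʷ proj₁ (Inverse.from (F (suc n)) (insertAt (Inverse.to (F n) w) i b)))
theorem4p4 K 2#0 n _ i b (w , J , w≈) u = mk⇔
  (λ minimal → _≅_.on (minimal⇒≅wᴶ K 2#0 J′ x x-sign {u} minimal))
  (λ u≈ → ≅wᴶ⇒minimal K 2#0 J′ x x-sign {u} (mk≅ u≈))
  where
  open TypeB K 2#0
  open Representatives
  x = 𝓘 n (i′ n i b) ++ ι w
  -- By definition, the inverse of `F (suc n)` sends the inserted bit string to `wᴶ J′`.
  J′ = support (insertAt (characteristic J) i b)
  x-sign = sign-𝓘-ι K 2#0 i b w J (mk≅ w≈)
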